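{- Let $n\ge1$, $m\ge0$, let $F_n$ be the free group on $z_1,\dots,z_n$, let $V_m=(v_1,\dots,v_m)$ be a tuple of words in $F_n$, and let $N$ be the normal closure of $\{v_1,\dots,v_m\}$ in $F_n$. Let $a,b$ be words in $F_n$. Then $FTL_{s1}(F_n,V_m,a)$ and $FTL_{s1}(F_n,V_m,b)$ are Hurwitz equivalent if and only if there exists $Y\in N$ such that $a^Y=b$ in $F_n$.
   Context: Conjugation notation: $a^b=b^{ -1}ab$. For a group $G_1\oplus G_2$, $R=(R_1,\dots,R_p)$, $W=(W_1,\dots,W_q)$, $H$ in $G_1$ and $X=(X_1,\dots,X_{q+2})$ in $G_2$, let $P_X(R,W,H)=((R_1,1),\dots,(R_p,1),(W_1,X_1),\dots,(W_q,X_q),(H^{ -1},X_{q+1}),(H,X_{q+2}))$. Let $F_X$ be the free group on $X_1,\dots,X_{n+1}$, and fix an injective homomorphism $i:F_n\oplus F_X\to F_2\oplus F_2$ ($F_2$ the free group of rank 2). Define $FTL_{s1}(F_n,V_m,a)=i(P_X(V_f,W,a))$ where $V_f=(v_1,\dots,v_m,(v_1\cdots v_m)^{ -1})$, $W=(z_1,\dots,z_n,(z_1\cdots z_n)^{ -1})$, and $X=(X_1,\dots,X_n,(X_1\cdots X_n)^{ -1},X_{n+1}^{ -1},X_{n+1})$ (applying $i$ entrywise); this is a $1$-factorization in $F_2\oplus F_2$. The braid group acts on the right on tuples of group elements by $(f_1,\dots,f_k)\sigma_i=(\dots,f_{i-1},f_{i+1},f_{i+1}^{ -1}f_if_{i+1},f_{i+2},\dots)$,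 $(f_1,\dots,f_k)\sigma_i^{ -1}=(\dots,f_{i-1},f_if_{i+1}f_i^{ -1},f_i,f_{i+2},\dots)$; Hurwitz equivalent means in the same orbit. -}

module Defs where

open import Data.Nat using (ℕ; zero; suc)
open import Data.Fin as Fin using (Fin; fromℕ; inject₁)
open import Data.Bool using (Bool; true; false; not; _∧_; _xor_)
open import Data.Product using (_×_; _,_; proj₁; proj₂)
open import Data.List using (List; []; _∷_; _++_; map; reverse; foldr; concat; zipWith)
open import Data.Vec as Vec using (Vec; lookup; toList)
open import Relation.Nullary using (does)
open import Relation.Binary.PropositionalEquality using (_≡_)
open import Relation.Binary.Construct.Closure.ReflexiveTransitive using (Star)
open import Data.List.Relation.Binary.Pointwise using (Pointwise)

-- Free group F_k on generators indexed by Fin k.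
-- Elements are represented by (not necessarily reduced) words;
-- a letter (g , true) is the generator g, (g , false) its inverse.
-- Two words are equal in F_k iff their free reductions coincide.

Letter : ℕ → Set
Letter k = Fin k × Bool

Word : ℕ → Set
Word k = List (Letter k)

invL : ∀ {k} → Letter k → Letter k
invL (g , s) = g , not s

cancels : ∀ {k} → Letter k → Letter k → Bool
cancels (g , s) (h , t) = does (g Fin.≟ h) ∧ (s xor t)

push : ∀ {k} → Letter k → Word k → Word k
push x [] = x ∷ []
push x (y ∷ ys) with cancels x y
... | true  = ys
... | false = x ∷ y ∷ ys

reduce : ∀ {k} → Word k → Word k
reduce = foldr push []

ε : ∀ {k} → Word k
ε = []

infixl 7 _·_
_·_ : ∀ {k} → Word k → Word k → Word k
u · v = u ++ v

_⁻¹ : ∀ {k} → Word k → Word k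
w ⁻¹ = reverse (map invL w)

infix 4 _≈_
_≈_ : ∀ {k} → Word k → Word k → Set
u ≈ v = reduce u ≡ reduce v

gen : ∀ {k} → Fin k → Word k
gen g = (g , true) ∷ []

prod : ∀ {k} → List (Word k) → Word k
prod = foldr _·_ ε

_^_ : ∀ {k} → Word k → Word k → Word k
a ^ b = (b ⁻¹) · a · b

Sum : ℕ → ℕ → Set
Sum a b = Word a × Word b

infix 4 _≈⊕_
_≈⊕_ : ∀ {a b} → Sum a b → Sum a b → Set
(x , y) ≈⊕ (x' , y') = (x ≈ x') × (y ≈ y')

infixl 7 _·⊕_
_·⊕_ : ∀ {a b} → Sum a b → Sum a b → Sum a b
(x , y) ·⊕ (x' , y') = (x · x') , (y · y')

_⁻¹⊕ : ∀ {a b} → Sum a b → Sum a b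
(x , y) ⁻¹⊕ = (x ⁻¹) , (y ⁻¹)

-- Injective group homomorphisms  i : F_n ⊕ F_X → F_2 ⊕ F_2,
-- where F_X is free on X_1, …, X_{n+1} (indexed by Fin (suc n)).

record Mono (n : ℕ) : Set where
  field
    fun  : Sum n (suc n) → Sum 2 2
    cong : ∀ {x y} → x ≈⊕ y → fun x ≈⊕ fun y
    hom  : ∀ x y → fun (x ·⊕ y) ≈⊕ (fun x ·⊕ fun y)
    inj  : ∀ {x y} → fun x ≈⊕ fun y → x ≈⊕ y

data HStep : List (Sum 2 2) → List (Sum 2 2) → Set where
  σ    : ∀ pre f g post →
         HStep (pre ++ f ∷ g ∷ post) (pre ++ g ∷ (g ⁻¹⊕ ·⊕ f ·⊕ g) ∷ post)
  σinv : ∀ pre f g post →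
         HStep (pre ++ f ∷ g ∷ post) (pre ++ (f ·⊕ g ·⊕ f ⁻¹⊕) ∷ f ∷ post)
  eq   : ∀ {s t} → Pointwise _≈⊕_ s t → HStep s t

HurwitzEquiv : List (Sum 2 2) → List (Sum 2 2) → Set
HurwitzEquiv = Star HStep

data InN {n m : ℕ} (V : Vec (Word n) m) : Word n → Set where
  conjGen : ∀ (j : Fin m) (g : Word n) → InN V (lookup V j ^ g)
  one     : InN V ε
  mul     : ∀ {x y} → InN V x → InN V y → InN V (x · y)
  inv     : ∀ {x} → InN V x → InN V (x ⁻¹)
  resp    : ∀ {x y} → x ≈ y → InN V x → InN V y

zs : (n : ℕ) → List (Word n)
zs n = toList (Vec.map gen (Vec.allFin n))

Xs : (n : ℕ) → List (Word (suc n))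
Xs n = toList (Vec.map (λ j → gen (inject₁ j)) (Vec.allFin n))

Xlast : (n : ℕ) → Word (suc n)
Xlast n = gen (fromℕ n)

PX : (n m : ℕ) → Vec (Word n) m → Word n → List (Sum n (suc n))
PX n m V H =
     map (λ r → r , ε) (toList V ++ (prod (toList V) ⁻¹) ∷ [])
  ++ zipWith _,_ (zs n ++ (prod (zs n) ⁻¹) ∷ [])
                 (Xs n ++ (prod (Xs n) ⁻¹) ∷ [])
  ++ ((H ⁻¹) , (Xlast n ⁻¹)) ∷ (H , Xlast n) ∷ []

FTLs1 : {n m : ℕ} → Mono n → Vec (Word n) m → Word n → List (Sum 2 2)
FTLs1 {n} {m} i V H = map (Mono.fun i) (PX n m V H)

-- A pair (h⁻¹, h) has product 1, so Hurwitz moves carry it across any entry f without change, and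
-- can also conjugate it by f. The pair ((a⁻¹, X⁻¹), (a, X)) with X = Xₙ₊₁ can thus be conjugated by
-- everything in the subgroup generated by the (vⱼ, 1) and (zⱼ, Xⱼ), which contains N × 1.
--
-- Conversely let φ : F_X → F_n send Xⱼ to zⱼ and X to a. Every element (p, q) of the subgroup
-- generated by the tuple satisfies p ∈ φ(q) N, so conjugating by such elements preserves the property
-- "q = 1 and p ∈ N, or p is N-conjugate to φ(q)". All entries of the first tuple have it, hence so
-- do all entries of the second; for its entry (b, X) it says that b is N-conjugate to φ(X) = a.
module Submission where

open import Defs
open import Level using (0ℓ)
open import Algebra.Bundles using (Group)
import Algebra.Construct.DirectProduct as DirectProduct
import Algebra.Properties.Group as GroupProperties
open import Data.Bool using (true; false)
open import Data.Fin using (Fin; zero; suc; inject₁; _≟_)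
open import Data.Fin.Relation.Unary.Top using (view; view-inject₁; view-fromℕ; View; ‵fromℕ; ‵inject₁)
open import Data.List using (List; []; _∷_; _++_; map; foldr; zipWith)
open import Data.List.Membership.Propositional using (_∈_)
open import Data.List.Membership.Propositional.Properties using (∈-++⁺ˡ; ∈-++⁺ʳ; ∈-map⁺; ∈-∃++)
open import Data.List.Properties using (++-assoc; ++-identityʳ; foldr-++; unfold-reverse; map-++)
open import Data.List.Relation.Binary.Pointwise as Pointwise using (Pointwise; []; _∷_)
open import Data.List.Relation.Unary.All as All using (All; []; _∷_)
import Data.List.Relation.Unary.All.Properties as All
open import Data.List.Relation.Unary.Any using (here; there)
open import Data.Nat using (ℕ; zero; suc; _≤_)
open import Data.Product using (Σ; ∃; _×_; _,_; proj₁; proj₂)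
open import Data.Sum using (_⊎_; inj₁; inj₂)
open import Data.Vec as Vec using (Vec; []; _∷_; lookup; toList)
open import Data.Vec.Membership.Propositional.Properties using (∈-lookup; ∈-toList⁺)
open import Data.Vec.Properties using (lookup-allFin)
import Data.Vec.Relation.Unary.All.Properties as VecAll
open import Function.Bundles using (_⇔_; mk⇔)
open import Relation.Binary.Construct.Closure.ReflexiveTransitive as Star using (_◅_; _◅◅_)
open import Relation.Binary.PropositionalEquality
  using (_≡_; refl; sym; trans; cong; cong₂; subst; module ≡-Reasoning)
open import Relation.Nullary using (yes; no; contradiction)

private
  variable
    k n m : ℕ

-- The free group

cancels⇒invL : (x y : Letter k) → cancels x y ≡ true → y ≡ invL x
cancels⇒invL (g , s) (h , t) p≡ with g ≟ h
cancels⇒invL (g , true)  (h , false) p≡ | yes refl = refl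
cancels⇒invL (g , false) (h , true)  p≡ | yes refl = refl

cancels-invL : (x : Letter k) → cancels x (invL x) ≡ true
cancels-invL (g , s) with g ≟ g
cancels-invL (g , true)  | yes _ = refl
cancels-invL (g , false) | yes _ = refl
cancels-invL (g , s)     | no g≢g = contradiction refl g≢g

invL-involutive : (x : Letter k) → invL (invL x) ≡ x
invL-involutive (g , true)  = refl
invL-involutive (g , false) = refl

-- The absence of cancellation at the head is stated as an equation on `push`, the form in which
-- `push-invL` consumes it.
data Reduced {k} : Word k → Set where
  []  : Reduced []
  _∷_ : ∀ {x w} → push x w ≡ x ∷ w → Reduced w → Reduced (x ∷ w)

push-reduced : ∀ (x : Letter k) {w} → Reduced w → Reduced (push x w)
push-reduced x []             = refl ∷ []
push-reduced x (_∷_ {y} {w} p r) with cancels x y in p≡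
... | true  = r
... | false = x∷y∷w ∷ p ∷ r
  where
  x∷y∷w : push x (y ∷ w) ≡ x ∷ y ∷ w
  x∷y∷w rewrite p≡ = refl

foldr-push-reduced : ∀ (u : Word k) {w} → Reduced w → Reduced (foldr push w u)
foldr-push-reduced []      r = r
foldr-push-reduced (x ∷ u) r = push-reduced x (foldr-push-reduced u r)

-- If `invL x` cancels the head `y`, then `y` is `x`, and reducedness says exactly that pushing `x`
-- back restores the word.
push-invL : ∀ (x : Letter k) {w} → Reduced w → push x (push (invL x) w) ≡ w
push-invL x [] rewrite cancels-invL x = refl
push-invL x (_∷_ {y} {w} p r) with cancels (invL x) y in p≡
... | true  rewrite trans (cancels⇒invL (invL x) y p≡) (invL-involutive x) = p
... | false rewrite cancels-invL x = refl

foldr-push-push : ∀ (x : Letter k) u {w} → Reduced w →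
                  foldr push w (push x u) ≡ push x (foldr push w u)
foldr-push-push x []      r = refl
foldr-push-push x (y ∷ u) r with cancels x y in p≡
... | false = refl
... | true  rewrite cancels⇒invL x y p≡ = sym (push-invL x (foldr-push-reduced u r))

-- Words act on reduced words by pushing their letters, and cancelling pairs act trivially by
-- `push-invL`. This is what makes `≈` a congruence for `·`.
foldr-push-reduce : ∀ (u : Word k) {w} → Reduced w →
                    foldr push w (reduce u) ≡ foldr push w u
foldr-push-reduce []      r = refl
foldr-push-reduce (x ∷ u) r =
  trans (foldr-push-push x (reduce u) r) (cong (push x) (foldr-push-reduce u r))

·-cong : ∀ {u u' v v' : Word k} → u ≈ u' → v ≈ v' → u · v ≈ u' · v'
·-cong {u = u} {u'} {v} {v'} u≈u' v≈v' = begin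
  reduce (u ++ v)                    ≡⟨ foldr-++ push [] u v ⟩
  foldr push (reduce v) u            ≡⟨ foldr-push-reduce u (foldr-push-reduced v []) ⟨
  foldr push (reduce v) (reduce u)   ≡⟨ cong₂ (foldr push) v≈v' u≈u' ⟩
  foldr push (reduce v') (reduce u') ≡⟨ foldr-push-reduce u' (foldr-push-reduced v' []) ⟩
  foldr push (reduce v') u'          ≡⟨ foldr-++ push [] u' v' ⟨
  reduce (u' ++ v')                  ∎
  where open ≡-Reasoning

·-congˡ : ∀ (u : Word k) v v' → v ≈ v' → u · v ≈ u · v'
·-congˡ u v v' v≈v' = ·-cong {u = u} {u} {v} {v'} refl v≈v'

·-congʳ : ∀ (v : Word k) u u' → u ≈ u' → u · v ≈ u' · v
·-congʳ v u u' u≈u' = ·-cong {u = u} {u'} {v} {v} u≈u' refl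

invL-cancel : ∀ (x : Letter k) w → x ∷ invL x ∷ w ≈ w
invL-cancel x w = push-invL x (foldr-push-reduced w [])

⁻¹-∷ : ∀ (x : Letter k) w → (x ∷ w) ⁻¹ ≡ w ⁻¹ · (invL x ∷ [])
⁻¹-∷ x w = unfold-reverse (invL x) (map invL w)

⁻¹-inverseˡ : (w : Word k) → w ⁻¹ · w ≈ ε
⁻¹-inverseˡ []      = refl
⁻¹-inverseˡ (x ∷ w) = begin
  reduce ((x ∷ w) ⁻¹ ++ x ∷ w)             ≡⟨ cong (λ v → reduce (v ++ x ∷ w)) (⁻¹-∷ x w) ⟩
  reduce ((w ⁻¹ ++ invL x ∷ []) ++ x ∷ w)  ≡⟨ cong reduce (++-assoc (w ⁻¹) _ _) ⟩
  reduce (w ⁻¹ ++ invL x ∷ x ∷ w)          ≡⟨ ·-congˡ (w ⁻¹) (invL x ∷ x ∷ w) w cancel ⟩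
  reduce (w ⁻¹ ++ w)                       ≡⟨ ⁻¹-inverseˡ w ⟩
  []                                       ∎
  where
  open ≡-Reasoning
  cancel : invL x ∷ x ∷ w ≈ w
  cancel = subst (λ y → invL x ∷ y ∷ w ≈ w) (invL-involutive x) (invL-cancel (invL x) w)

⁻¹-inverseʳ : (w : Word k) → w · w ⁻¹ ≈ ε
⁻¹-inverseʳ []      = refl
⁻¹-inverseʳ (x ∷ w) = begin
  reduce (x ∷ w ++ (x ∷ w) ⁻¹)             ≡⟨ cong (λ v → reduce (x ∷ w ++ v)) (⁻¹-∷ x w) ⟩
  reduce (x ∷ w ++ (w ⁻¹ ++ invL x ∷ []))  ≡⟨ cong (λ v → reduce (x ∷ v)) (++-assoc w _ _) ⟨
  push x (reduce ((w · w ⁻¹) · (invL x ∷ [])))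
    ≡⟨ cong (push x) (·-congʳ (invL x ∷ []) (w · w ⁻¹) ε (⁻¹-inverseʳ w)) ⟩
  reduce (x ∷ invL x ∷ [])                 ≡⟨ invL-cancel x [] ⟩
  []                                       ∎
  where open ≡-Reasoning

-- Uniqueness of inverses: `v ⁻¹` is also a right inverse of `u`. This avoids comparing how two
-- words with the same reduction cancel.
⁻¹-cong : ∀ {u v : Word k} → u ≈ v → u ⁻¹ ≈ v ⁻¹
⁻¹-cong {u = u} {v} u≈v = begin
  reduce (u ⁻¹)               ≡⟨ cong reduce (++-identityʳ (u ⁻¹)) ⟨
  reduce (u ⁻¹ · ε)           ≡⟨ ·-congˡ (u ⁻¹) (v · v ⁻¹) ε (⁻¹-inverseʳ v) ⟨
  reduce (u ⁻¹ · (v · v ⁻¹))  ≡⟨ ·-congˡ (u ⁻¹) (u · v ⁻¹) (v · v ⁻¹) (·-congʳ (v ⁻¹) u v u≈v) ⟨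
  reduce (u ⁻¹ · (u · v ⁻¹))  ≡⟨ cong reduce (++-assoc (u ⁻¹) u (v ⁻¹)) ⟨
  reduce (u ⁻¹ · u · v ⁻¹)    ≡⟨ ·-congʳ (v ⁻¹) (u ⁻¹ · u) ε (⁻¹-inverseˡ u) ⟩
  reduce (v ⁻¹)               ∎
  where open ≡-Reasoning

freeGroup : ℕ → Group 0ℓ 0ℓ
freeGroup k = record
  { Carrier = Word k
  ; _≈_ = _≈_
  ; _∙_ = _·_
  ; ε   = ε
  ; _⁻¹ = _⁻¹
  ; isGroup = record
    { isMonoid = record
      { isSemigroup = record
        { isMagma = record
          { isEquivalence = record { refl = refl ; sym = sym ; trans = trans }
          ; ∙-cong = λ {u} {u'} {v} {v'} → ·-cong {u = u} {u'} {v} {v'}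
          }
        ; assoc = λ u v w → cong reduce (++-assoc u v w)
        }
      ; identity = (λ _ → refl) , λ u → cong reduce (++-identityʳ u)
      }
    ; inverse = ⁻¹-inverseˡ , ⁻¹-inverseʳ
    ; ⁻¹-cong = λ {u} {v} → ⁻¹-cong {u = u} {v}
    }
  }

-- Group identities by evaluation of free words

infixl 7 _⊙_
infix  8 _⁻

data Expr (k : ℕ) : Set where
  var : Fin k → Expr k
  _⊙_ : Expr k → Expr k → Expr k
  _⁻  : Expr k → Expr k

word : Expr k → Word k
word (var i)   = gen i
word (e₁ ⊙ e₂) = word e₁ · word e₂
word (e ⁻)     = word e ⁻¹

module Evaluation (G : Group 0ℓ 0ℓ) where
  open Group G renaming (_≈_ to _≈ᴳ_; ⁻¹-cong to ⁻¹ᴳ-cong; _⁻¹ to _⁻¹ᴳ; ε to εᴳ; refl to reflᴳ; sym to symᴳ; trans to transᴳ)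
  open GroupProperties G
  open import Relation.Binary.Reasoning.Setoid setoid

  module _ (ρ : Fin k → Carrier) where

    evalLetter : Letter k → Carrier
    evalLetter (g , true)  = ρ g
    evalLetter (g , false) = ρ g ⁻¹ᴳ

    eval : Word k → Carrier
    eval = foldr (λ x y → evalLetter x ∙ y) εᴳ

    evalLetter-inverseʳ : ∀ x → evalLetter x ∙ evalLetter (invL x) ≈ᴳ εᴳ
    evalLetter-inverseʳ (g , true)  = inverseʳ (ρ g)
    evalLetter-inverseʳ (g , false) = inverseˡ (ρ g)

    -- In the cancelling case the two deleted letters have mutually inverse values. Hence evaluation
    -- respects `≈`, the universal property of the free group.
    eval-push : ∀ x w → eval (push x w) ≈ᴳ evalLetter x ∙ eval w
    eval-push x []      = reflᴳ
    eval-push x (y ∷ w) with cancels x y in p≡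
    ... | false = reflᴳ
    ... | true rewrite cancels⇒invL x y p≡ = begin
      eval w                                              ≈⟨ identityˡ _ ⟨
      εᴳ ∙ eval w                                         ≈⟨ ∙-congʳ (evalLetter-inverseʳ x) ⟨
      evalLetter x ∙ evalLetter (invL x) ∙ eval w         ≈⟨ assoc _ _ _ ⟩
      evalLetter x ∙ (evalLetter (invL x) ∙ eval w)       ∎

    eval-reduce : ∀ w → eval (reduce w) ≈ᴳ eval w
    eval-reduce []      = reflᴳ
    eval-reduce (x ∷ w) = transᴳ (eval-push x (reduce w)) (∙-congˡ (eval-reduce w))

    eval-cong : ∀ {u v} → u ≈ v → eval u ≈ᴳ eval v
    eval-cong {u} {v} u≈v = begin
      eval u           ≈⟨ eval-reduce u ⟨
      eval (reduce u)  ≡⟨ cong eval u≈v ⟩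
      eval (reduce v)  ≈⟨ eval-reduce v ⟩
      eval v           ∎

    eval-· : ∀ u v → eval (u · v) ≈ᴳ eval u ∙ eval v
    eval-· []      v = symᴳ (identityˡ _)
    eval-· (x ∷ u) v = transᴳ (∙-congˡ (eval-· u v)) (symᴳ (assoc _ _ _))

    eval-⁻¹ : ∀ u → eval (u ⁻¹) ≈ᴳ eval u ⁻¹ᴳ
    eval-⁻¹ u = inverseˡ-unique _ _ (transᴳ (symᴳ (eval-· (u ⁻¹) u)) (eval-cong {u ⁻¹ · u} {ε} (⁻¹-inverseˡ u)))

    ⟦_⟧ : Expr k → Carrier
    ⟦ var i ⟧   = ρ i
    ⟦ e₁ ⊙ e₂ ⟧ = ⟦ e₁ ⟧ ∙ ⟦ e₂ ⟧
    ⟦ e ⁻ ⟧     = ⟦ e ⟧ ⁻¹ᴳ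

    eval-word : ∀ e → eval (word e) ≈ᴳ ⟦ e ⟧
    eval-word (var i)   = identityʳ (ρ i)
    eval-word (e₁ ⊙ e₂) = transᴳ (eval-· (word e₁) (word e₂)) (∙-cong (eval-word e₁) (eval-word e₂))
    eval-word (e ⁻)     = transᴳ (eval-⁻¹ (word e)) (⁻¹ᴳ-cong (eval-word e))

  -- An identity between group expressions holds in every group as soon as it holds in the
  -- free group on its variables, where it is decided by free reduction.
  solve : (e₁ e₂ : Expr k) → word e₁ ≈ word e₂ → (xs : Vec Carrier k) →
          ⟦ lookup xs ⟧ e₁ ≈ᴳ ⟦ lookup xs ⟧ e₂
  solve e₁ e₂ e₁≈e₂ xs = begin
    ⟦ lookup xs ⟧ e₁          ≈⟨ eval-word (lookup xs) e₁ ⟨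
    eval (lookup xs) (word e₁) ≈⟨ eval-cong (lookup xs) {word e₁} {word e₂} e₁≈e₂ ⟩
    eval (lookup xs) (word e₂) ≈⟨ eval-word (lookup xs) e₂ ⟩
    ⟦ lookup xs ⟧ e₂          ∎

sumGroup : ℕ → ℕ → Group 0ℓ 0ℓ
sumGroup a b = DirectProduct.group (freeGroup a) (freeGroup b)

infixl 8 _^ᵉ_
_^ᵉ_ : Expr k → Expr k → Expr k
e ^ᵉ f = f ⁻ ⊙ e ⊙ f

pattern x₀ = var zero
pattern x₁ = var (suc zero)
pattern x₂ = var (suc (suc zero))
pattern x₃ = var (suc (suc (suc zero)))

-- Conjugation and the normal closure

^-cong : ∀ (u u' v v' : Word k) → u ≈ u' → v ≈ v' → u ^ v ≈ u' ^ v'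
^-cong u u' v v' u≈u' v≈v' =
  ·-cong {u = v ⁻¹ · u} {v' ⁻¹ · u'} {v} {v'}
    (·-cong {u = v ⁻¹} {v' ⁻¹} {u} {u'} (⁻¹-cong {u = v} {v'} v≈v') u≈u') v≈v'

module F {k} = Evaluation (freeGroup k)

^-ε : (u : Word k) → u ^ ε ≈ u
^-ε u = cong reduce (++-identityʳ u)

ε-^ : (u : Word k) → ε ^ u ≈ ε
ε-^ u = trans (·-congʳ u (u ⁻¹ · ε) (u ⁻¹) (cong reduce (++-identityʳ (u ⁻¹)))) (⁻¹-inverseˡ u)

-- `InN` has conjugates of the generators only. Normality follows because conjugation is an
-- automorphism, and conjugating by `h` and then by `g` is conjugating by `h · g`.
InN-^ : ∀ {V : Vec (Word n) m} {x} → InN V x → ∀ g → InN V (x ^ g)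
InN-^ {V = V} (conjGen j h) g =
  resp {x = lookup V j ^ (h · g)}
    (F.solve (x₀ ^ᵉ (x₁ ⊙ x₂)) (x₀ ^ᵉ x₁ ^ᵉ x₂) refl (lookup V j ∷ h ∷ g ∷ [])) (conjGen j (h · g))
InN-^ one g = resp {x = ε} (sym (ε-^ g)) one
InN-^ (mul {x} {y} x∈N y∈N) g =
  resp {x = x ^ g · y ^ g}
    (F.solve (x₀ ^ᵉ x₂ ⊙ x₁ ^ᵉ x₂) ((x₀ ⊙ x₁) ^ᵉ x₂) refl (x ∷ y ∷ g ∷ [])) (mul (InN-^ x∈N g) (InN-^ y∈N g))
InN-^ (inv {x} x∈N) g =
  resp {x = (x ^ g) ⁻¹} (F.solve ((x₀ ^ᵉ x₁) ⁻) (x₀ ⁻ ^ᵉ x₁) refl (x ∷ g ∷ [])) (inv (InN-^ x∈N g))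
InN-^ (resp {x} {y} x≈y x∈N) g = resp {x = x ^ g} (^-cong x y g g x≈y refl) (InN-^ x∈N g)

InN-lookup : ∀ (V : Vec (Word n) m) j → InN V (lookup V j)
InN-lookup V j = resp {x = lookup V j ^ ε} (^-ε (lookup V j)) (conjGen j ε)

InN-prod : ∀ {V : Vec (Word n) m} {ws} → All (InN V) ws → InN V (prod ws)
InN-prod []           = one
InN-prod (w∈N ∷ ws∈N) = mul w∈N (InN-prod ws∈N)

infixl 8 _^⊕_
_^⊕_ : ∀ {a b} → Sum a b → Sum a b → Sum a b
x ^⊕ y = y ⁻¹⊕ ·⊕ x ·⊕ y

^⊕-cong : ∀ {a b} (x x' y y' : Sum a b) → x ≈⊕ x' → y ≈⊕ y' → x ^⊕ y ≈⊕ x' ^⊕ y'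
^⊕-cong x x' y y' (p , q) (r , s) =
  ^-cong (proj₁ x) (proj₁ x') (proj₁ y) (proj₁ y') p r , ^-cong (proj₂ x) (proj₂ x') (proj₂ y) (proj₂ y') q s

module S {a b} = Evaluation (sumGroup a b)

≈⊕-sym : ∀ {a b} (x y : Sum a b) → x ≈⊕ y → y ≈⊕ x
≈⊕-sym x y (p , q) = sym p , sym q

≈⊕-trans : ∀ {a b} (x y z : Sum a b) → x ≈⊕ y → y ≈⊕ z → x ≈⊕ z
≈⊕-trans x y z (p , q) (r , s) = trans p r , trans q s

⁻¹⊕-cong : ∀ {a b} (x y : Sum a b) → x ≈⊕ y → x ⁻¹⊕ ≈⊕ y ⁻¹⊕
⁻¹⊕-cong (u , v) (u' , v') (p , q) = ⁻¹-cong {u = u} {u'} p , ⁻¹-cong {u = v} {v'} q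

-- Hurwitz moves

Pointwise-≈⊕-refl : ∀ {xs : List (Sum 2 2)} → Pointwise _≈⊕_ xs xs
Pointwise-≈⊕-refl = Pointwise.refl (refl , refl)

HStep-∷ : ∀ x {s t} → HStep s t → HStep (x ∷ s) (x ∷ t)
HStep-∷ x (σ pre f g post)    = σ (x ∷ pre) f g post
HStep-∷ x (σinv pre f g post) = σinv (x ∷ pre) f g post
HStep-∷ x (eq s≈t)            = eq ((refl , refl) ∷ s≈t)

HurwitzEquiv-++ : ∀ pre {s t} → HurwitzEquiv s t → HurwitzEquiv (pre ++ s) (pre ++ t)
HurwitzEquiv-++ []        s~t = s~t
HurwitzEquiv-++ (x ∷ pre) s~t = Star.gmap (x ∷_) (HStep-∷ x) (HurwitzEquiv-++ pre s~t)

HurwitzEquiv-≡ : ∀ {s t} → s ≡ t → HurwitzEquiv s t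
HurwitzEquiv-≡ refl = Star.ε

-- The opposite move undoes a move only up to free reduction, so an `eq` step follows it.
HStep-sym : ∀ {s t} → HStep s t → HurwitzEquiv t s
HStep-sym (σ pre f g post) = HurwitzEquiv-++ pre
  (σinv [] g (f ^⊕ g) post
  ◅ eq (S.solve (x₁ ⊙ x₀ ^ᵉ x₁ ⊙ x₁ ⁻) x₀ refl (f ∷ g ∷ []) ∷ Pointwise-≈⊕-refl) ◅ Star.ε)
HStep-sym (σinv pre f g post) = HurwitzEquiv-++ pre
  (σ [] (f ·⊕ g ·⊕ f ⁻¹⊕) f post
  ◅ eq ((refl , refl) ∷ S.solve ((x₀ ⊙ x₁ ⊙ x₀ ⁻) ^ᵉ x₀) x₁ refl (f ∷ g ∷ []) ∷ Pointwise-≈⊕-refl) ◅ Star.ε)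
HStep-sym (eq s≈t) = eq (Pointwise.symmetric (λ {x} {y} → ≈⊕-sym x y) s≈t) ◅ Star.ε

HurwitzEquiv-sym : ∀ {s t} → HurwitzEquiv s t → HurwitzEquiv t s
HurwitzEquiv-sym Star.ε      = Star.ε
HurwitzEquiv-sym (st ◅ t~u) = HurwitzEquiv-sym t~u ◅◅ HStep-sym st

-- The only new entry of a move is a conjugate of an old one: `f` by `g` for `σ`, and `g` by `f ⁻¹⊕`
-- for `σinv`.
All-HStep : ∀ {Q : Sum 2 2 → Set} →
            (∀ {x y} → x ≈⊕ y → Q x → Q y) →
            (∀ {x} → Q x → Q (x ⁻¹⊕)) →
            (∀ {x y} → Q x → Q y → Q (x ^⊕ y)) →
            ∀ {s t} → HStep s t → All Q s → All Q t
All-HStep Q-≈ Q-⁻¹ Q-^ (σ pre f g post) qs with All.++⁻ pre qs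
... | qpre , qf ∷ qg ∷ qpost = All.++⁺ qpre (qg ∷ Q-^ qf qg ∷ qpost)
All-HStep Q-≈ Q-⁻¹ Q-^ (σinv pre f g post) qs with All.++⁻ pre qs
... | qpre , qf ∷ qg ∷ qpost = All.++⁺ qpre (Q-≈ fgf⁻¹ (Q-^ qg (Q-⁻¹ qf)) ∷ qf ∷ qpost)
  where
  fgf⁻¹ : g ^⊕ (f ⁻¹⊕) ≈⊕ f ·⊕ g ·⊕ f ⁻¹⊕
  fgf⁻¹ = S.solve (x₁ ^ᵉ (x₀ ⁻)) (x₀ ⊙ x₁ ⊙ x₀ ⁻) refl (f ∷ g ∷ [])
All-HStep Q-≈ Q-⁻¹ Q-^ (eq s≈t) qs = Pointwise.All-resp-Pointwise Q-≈ s≈t qs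

dipole : Sum 2 2 → List (Sum 2 2)
dipole h = h ⁻¹⊕ ∷ h ∷ []

dipole-cong : ∀ L (h h' : Sum 2 2) → h ≈⊕ h' → HurwitzEquiv (L ++ dipole h) (L ++ dipole h')
dipole-cong L h h' h≈h' = HurwitzEquiv-++ L (eq (⁻¹⊕-cong h h' h≈h' ∷ h≈h' ∷ []) ◅ Star.ε)

-- Crossing the pair conjugates `f` first by `h ⁻¹⊕` and then by `h`, which cancels.
dipole-∷ : ∀ h f post → HurwitzEquiv (f ∷ dipole h ++ post) (dipole h ++ f ∷ post)
dipole-∷ h f post =
  σ [] f (h ⁻¹⊕) (h ∷ post) ◅ σ (h ⁻¹⊕ ∷ []) (f ^⊕ (h ⁻¹⊕)) h post
  ◅ eq ((refl , refl) ∷ (refl , refl) ∷ S.solve (x₀ ^ᵉ (x₁ ⁻) ^ᵉ x₁) x₀ refl (f ∷ h ∷ []) ∷ Pointwise-≈⊕-refl)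
  ◅ Star.ε

dipole-++ : ∀ h us → HurwitzEquiv (us ++ dipole h) (dipole h ++ us)
dipole-++ h []       = Star.ε
dipole-++ h (f ∷ us) = HurwitzEquiv-++ (f ∷ []) (dipole-++ h us) ◅◅ dipole-∷ h f us

-- Here `f` is the right entry of both moves, so it stays intact and each member of the pair is
-- conjugated by it.
dipole-^-∷ : ∀ h f post → HurwitzEquiv (dipole h ++ f ∷ post) (f ∷ dipole (h ^⊕ f) ++ post)
dipole-^-∷ h f post =
  σ (h ⁻¹⊕ ∷ []) h f post ◅ σ [] (h ⁻¹⊕) f (h ^⊕ f ∷ post)
  ◅ eq ((refl , refl) ∷ S.solve (x₁ ⁻ ^ᵉ x₀) ((x₁ ^ᵉ x₀) ⁻) refl (f ∷ h ∷ []) ∷ Pointwise-≈⊕-refl)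
  ◅ Star.ε

-- Split `L` as `pre ++ f ∷ us`. The pair goes left past `us` and `f` unchanged, returns over `f` by
-- the crossing that conjugates it, and then goes right past `us`.
dipole-^ : ∀ {L f} → f ∈ L → ∀ h → HurwitzEquiv (L ++ dipole h) (L ++ dipole (h ^⊕ f))
dipole-^ {f = f} f∈L h with ∈-∃++ f∈L
... | pre , us , refl =
  HurwitzEquiv-≡ (++-assoc pre (f ∷ us) (dipole h))
  ◅◅ HurwitzEquiv-++ pre
      (HurwitzEquiv-++ (f ∷ []) (dipole-++ h us) ◅◅ dipole-∷ h f us ◅◅ dipole-^-∷ h f us
      ◅◅ HurwitzEquiv-++ (f ∷ []) (HurwitzEquiv-sym (dipole-++ (h ^⊕ f) us)))
  ◅◅ HurwitzEquiv-≡ (sym (++-assoc pre (f ∷ us) (dipole (h ^⊕ f))))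

-- Homomorphism laws for `i`

module MonoProperties (i : Mono n) where
  open Mono i renaming (cong to fun-cong)

  private
    module G = GroupProperties (sumGroup 2 2)

  fun-ε : fun (ε , ε) ≈⊕ (ε , ε)
  -- The image is idempotent, as `(ε , ε) ·⊕ (ε , ε)` computes to `(ε , ε)`.
  fun-ε = G.identityˡ-unique e e (≈⊕-sym e (e ·⊕ e) (hom (ε , ε) (ε , ε)))
    where e = fun (ε , ε)

  fun-⁻¹ : ∀ x → fun (x ⁻¹⊕) ≈⊕ fun x ⁻¹⊕
  fun-⁻¹ x = G.inverseˡ-unique (fun (x ⁻¹⊕)) (fun x)
    (≈⊕-trans (fun (x ⁻¹⊕) ·⊕ fun x) (fun (ε , ε)) (ε , ε)
      (≈⊕-trans (fun (x ⁻¹⊕) ·⊕ fun x) (fun (x ⁻¹⊕ ·⊕ x)) (fun (ε , ε))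
        (≈⊕-sym (fun (x ⁻¹⊕ ·⊕ x)) (fun (x ⁻¹⊕) ·⊕ fun x) (hom (x ⁻¹⊕) x))
        (fun-cong {x ⁻¹⊕ ·⊕ x} {ε , ε} (⁻¹-inverseˡ (proj₁ x) , ⁻¹-inverseˡ (proj₂ x))))
      fun-ε)

  fun-^ : ∀ x y → fun (x ^⊕ y) ≈⊕ fun x ^⊕ fun y
  fun-^ x y = begin
    fun (x ^⊕ y)                       ≈⟨ hom (y ⁻¹⊕ ·⊕ x) y ⟩
    fun (y ⁻¹⊕ ·⊕ x) ·⊕ fun y          ≈⟨ ∙-cong {fun (y ⁻¹⊕ ·⊕ x)} {fun (y ⁻¹⊕) ·⊕ fun x} {fun y} {fun y}
                                            (hom (y ⁻¹⊕) x) (refl , refl) ⟩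
    fun (y ⁻¹⊕) ·⊕ fun x ·⊕ fun y      ≈⟨ ∙-cong {fun (y ⁻¹⊕) ·⊕ fun x} {fun y ⁻¹⊕ ·⊕ fun x} {fun y} {fun y}
                                            (∙-cong {fun (y ⁻¹⊕)} {fun y ⁻¹⊕} {fun x} {fun x}
                                              (fun-⁻¹ y) (refl , refl)) (refl , refl) ⟩
    fun x ^⊕ fun y                     ∎
    where
    open Group (sumGroup 2 2) using (∙-cong; setoid)
    open import Relation.Binary.Reasoning.Setoid setoid

-- Conjugators of a final pair (h⁻¹, h) realised by Hurwitz moves

module Realisation (L : List (Sum 2 2)) where

  -- The quantifier over `h` lets conjugators compose, since the second of two conjugations starts
  -- from `h ^⊕ c`. The realised conjugators thus form a subgroup containing the entries of `L`.
  Realises : Sum 2 2 → Set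
  Realises c = ∀ h → HurwitzEquiv (L ++ dipole h) (L ++ dipole (h ^⊕ c))

  realises-∈ : ∀ {f} → f ∈ L → Realises f
  realises-∈ = dipole-^

  realises-≈ : ∀ c c' → c ≈⊕ c' → Realises c → Realises c'
  realises-≈ c c' c≈c' r h = r h ◅◅ dipole-cong L (h ^⊕ c) (h ^⊕ c') (^⊕-cong h h c c' (refl , refl) c≈c')

  realises-ε : Realises (ε , ε)
  realises-ε (u , v) = dipole-cong L (u , v) ((u , v) ^⊕ (ε , ε)) (sym (^-ε u) , sym (^-ε v))

  realises-· : ∀ c d → Realises c → Realises d → Realises (c ·⊕ d)
  realises-· c d r s h = r h ◅◅ s (h ^⊕ c)
    ◅◅ dipole-cong L (h ^⊕ c ^⊕ d) (h ^⊕ (c ·⊕ d))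
         (S.solve (x₀ ^ᵉ x₁ ^ᵉ x₂) (x₀ ^ᵉ (x₁ ⊙ x₂)) refl (h ∷ c ∷ d ∷ []))

  realises-⁻¹ : ∀ c → Realises c → Realises (c ⁻¹⊕)
  realises-⁻¹ c r h =
    -- The moves for `c` can be run backwards only from a pair of the form `h' ^⊕ c`; here `h'` is
    -- `h ^⊕ (c ⁻¹⊕)`.
    dipole-cong L h (h ^⊕ (c ⁻¹⊕) ^⊕ c) (S.solve x₀ (x₀ ^ᵉ (x₁ ⁻) ^ᵉ x₁) refl (h ∷ c ∷ []))
    ◅◅ HurwitzEquiv-sym (r (h ^⊕ (c ⁻¹⊕)))

-- From conjugacy by an element of N to Hurwitz equivalence

module _ (i : Mono n) (V : Vec (Word n) m) where
  open Mono i renaming (cong to fun-cong)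
  open MonoProperties i

  frame : List (Sum n (suc n))
  frame = map (λ r → r , ε) (toList V ++ (prod (toList V) ⁻¹) ∷ [])
       ++ zipWith _,_ (zs n ++ (prod (zs n) ⁻¹) ∷ []) (Xs n ++ (prod (Xs n) ⁻¹) ∷ [])

  open Realisation (map fun frame)

  FTLs1-dipole : ∀ H → HurwitzEquiv (FTLs1 i V H) (map fun frame ++ dipole (fun (H , Xlast n)))
  FTLs1-dipole H = HurwitzEquiv-≡ FTLs1≡
    -- `fun` sends an inverse to the inverse of the image only up to `≈⊕`, hence the `eq` step.
    ◅◅ HurwitzEquiv-++ (map fun frame) (eq (fun-⁻¹ (H , Xlast n) ∷ (refl , refl) ∷ []) ◅ Star.ε)
    where
    FTLs1≡ : FTLs1 i V H ≡ map fun frame ++ fun ((H , Xlast n) ⁻¹⊕) ∷ fun (H , Xlast n) ∷ []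
    FTLs1≡ = trans (cong (map fun) (sym (++-assoc (map (λ r → r , ε) (toList V ++ (prod (toList V) ⁻¹) ∷ [])) _ _)))
                   (map-++ fun frame _)

  fun-realises-· : ∀ x y → Realises (fun x) → Realises (fun y) → Realises (fun (x ·⊕ y))
  fun-realises-· x y r s =
    realises-≈ (fun x ·⊕ fun y) (fun (x ·⊕ y)) (≈⊕-sym (fun (x ·⊕ y)) (fun x ·⊕ fun y) (hom x y))
      (realises-· (fun x) (fun y) r s)

  fun-realises-⁻¹ : ∀ x → Realises (fun x) → Realises (fun (x ⁻¹⊕))
  fun-realises-⁻¹ x r =
    realises-≈ (fun x ⁻¹⊕) (fun (x ⁻¹⊕)) (≈⊕-sym (fun (x ⁻¹⊕)) (fun x ⁻¹⊕) (fun-⁻¹ x)) (realises-⁻¹ (fun x) r)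

  zip-∈ : ∀ {A B C : Set} (f : A → B) (g : A → C) {k} (xs : Vec A k) {bs cs} j →
          (f (lookup xs j) , g (lookup xs j)) ∈ zipWith _,_ (toList (Vec.map f xs) ++ bs) (toList (Vec.map g xs) ++ cs)
  zip-∈ f g (x ∷ xs) zero    = here refl
  zip-∈ f g (x ∷ xs) (suc j) = there (zip-∈ f g xs j)

  v∈frame : ∀ j → (lookup V j , ε) ∈ frame
  v∈frame j = ∈-++⁺ˡ (∈-map⁺ (λ r → r , ε) (∈-++⁺ˡ (∈-toList⁺ (∈-lookup j V))))

  z∈frame : ∀ j → (gen j , gen (inject₁ j)) ∈ frame
  z∈frame j = ∈-++⁺ʳ (map (λ r → r , ε) (toList V ++ (prod (toList V) ⁻¹) ∷ [])) 
    (subst (λ l → (gen l , gen (inject₁ l)) ∈ _) (lookup-allFin j) (zip-∈ gen (λ l → gen (inject₁ l)) (Vec.allFin n) j))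

  -- The pairs `(g , lift g)` are the products of the entries `(zⱼ , Xⱼ)` and their inverses, so
  -- every `g` is the first coordinate of a realised conjugator.
  lift : Word n → Word (suc n)
  lift = map (λ (j , s) → inject₁ j , s)

  realises-lift : ∀ g → Realises (fun (g , lift g))
  realises-lift [] = realises-≈ (ε , ε) (fun (ε , ε)) (≈⊕-sym (fun (ε , ε)) (ε , ε) fun-ε) realises-ε
  realises-lift ((j , true) ∷ g) =
    fun-realises-· (gen j , gen (inject₁ j)) (g , lift g)
      (realises-∈ (∈-map⁺ fun (z∈frame j))) (realises-lift g)
  realises-lift ((j , false) ∷ g) =
    fun-realises-· ((gen j , gen (inject₁ j)) ⁻¹⊕) (g , lift g)
      (fun-realises-⁻¹ (gen j , gen (inject₁ j)) (realises-∈ (∈-map⁺ fun (z∈frame j)))) (realises-lift g)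

  realises-InN : ∀ {Y} → InN V Y → Realises (fun (Y , ε))
  realises-InN (conjGen j g) =
    -- Since `v` has trivial second coordinate, conjugating it by `ĝ` makes the unwanted `lift g`
    -- disappear.
    realises-≈ (fun (v ^⊕ ĝ)) (fun (lookup V j ^ g , ε))
      (fun-cong {v ^⊕ ĝ} {lookup V j ^ g , ε} (refl , ε-^ (lift g)))
      (fun-realises-· (ĝ ⁻¹⊕ ·⊕ v) ĝ
        (fun-realises-· (ĝ ⁻¹⊕) v (fun-realises-⁻¹ ĝ (realises-lift g)) (realises-∈ (∈-map⁺ fun (v∈frame j))))
        (realises-lift g))
    where
    v ĝ : Sum n (suc n)
    v = lookup V j , ε
    ĝ = g , lift g
  realises-InN one = realises-lift ε
  realises-InN (mul {x} {y} x∈N y∈N) = fun-realises-· (x , ε) (y , ε) (realises-InN x∈N) (realises-InN y∈N)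
  realises-InN (inv {x} x∈N) = fun-realises-⁻¹ (x , ε) (realises-InN x∈N)
  realises-InN (resp {x} {y} x≈y x∈N) =
    realises-≈ (fun (x , ε)) (fun (y , ε)) (fun-cong {x , ε} {y , ε} (x≈y , refl)) (realises-InN x∈N)

  conjugate⇒HurwitzEquiv : ∀ {a b Y} → InN V Y → a ^ Y ≈ b → HurwitzEquiv (FTLs1 i V a) (FTLs1 i V b)
  conjugate⇒HurwitzEquiv {a} {b} {Y} Y∈N aʸ≈b =
    FTLs1-dipole a
    ◅◅ realises-InN Y∈N (fun (a , Xlast n))
    ◅◅ dipole-cong (map fun frame) (fun (a , Xlast n) ^⊕ fun (Y , ε)) (fun (b , Xlast n))
         (≈⊕-trans (fun (a , Xlast n) ^⊕ fun (Y , ε)) (fun ((a , Xlast n) ^⊕ (Y , ε))) (fun (b , Xlast n))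
           (≈⊕-sym (fun ((a , Xlast n) ^⊕ (Y , ε))) (fun (a , Xlast n) ^⊕ fun (Y , ε)) (fun-^ (a , Xlast n) (Y , ε)))
           -- Conjugation by `ε` in the second coordinate leaves `Xlast n` as it is, so only `a`
           -- changes.
           (fun-cong {(a , Xlast n) ^⊕ (Y , ε)} {b , Xlast n} (aʸ≈b , refl)))
    ◅◅ HurwitzEquiv-sym (FTLs1-dipole b)

-- An invariant of Hurwitz moves

module Invariant (V : Vec (Word n) m) (a : Word n) where

  -- `‵fromℕ` is the index of the last generator of F_X. Taking the view as an argument lets
  -- `view-inject₁` and `view-fromℕ` compute `ρ` by rewriting.
  top⇒word : ∀ {n} → Word n → {j : Fin (suc n)} → View j → Word n
  top⇒word w ‵fromℕ       = w
  top⇒word w (‵inject₁ j) = gen j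

  ρ : Fin (suc n) → Word n
  ρ j = top⇒word a (view j)

  φ : Word (suc n) → Word n
  φ = F.eval ρ

  ρ-inject₁ : ∀ j → ρ (inject₁ j) ≡ gen j
  ρ-inject₁ j rewrite view-inject₁ j = refl

  φ-Xlast : φ (Xlast n) ≡ a
  φ-Xlast rewrite view-fromℕ n = ++-identityʳ a

  φ-^ : ∀ q q' → φ (q ^ q') ≈ φ q ^ φ q'
  φ-^ q q' = begin
    reduce (φ (q' ⁻¹ · q · q'))        ≡⟨ F.eval-· ρ (q' ⁻¹ · q) q' ⟩
    reduce (φ (q' ⁻¹ · q) · φ q')      ≡⟨ ·-congʳ (φ q') (φ (q' ⁻¹ · q)) (φ (q' ⁻¹) · φ q) (F.eval-· ρ (q' ⁻¹) q) ⟩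
    reduce (φ (q' ⁻¹) · φ q · φ q')    ≡⟨ ·-congʳ (φ q') (φ (q' ⁻¹) · φ q) (φ q' ⁻¹ · φ q)
                                            (·-congʳ (φ q) (φ (q' ⁻¹)) (φ q' ⁻¹) (F.eval-⁻¹ ρ q')) ⟩
    reduce (φ q ^ φ q')                ∎
    where open ≡-Reasoning

  -- The elements (p , q) for which p is conjugate to φ q by an element of N, except that for
  -- q ≈ ε the first component may be any element of N.
  Admissible : Sum n (suc n) → Set
  Admissible (p , q) = (q ≈ ε × InN V p) ⊎ ∃ λ Y → InN V Y × p ≈ φ q ^ Y

  -- A conjugate `φ q ^ Y` is `φ q` times the commutator of `φ q` and `Y`, which lies in N by
  -- normality.
  admissible⇒coset : ∀ {x} → Admissible x → ∃ λ k → InN V k × proj₁ x ≈ φ (proj₂ x) · k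
  admissible⇒coset {p , q} (inj₁ (q≈ε , p∈N)) = p , p∈N , sym (·-congʳ p (φ q) ε (F.eval-cong ρ {q} {ε} q≈ε))
  admissible⇒coset {p , q} (inj₂ (Y , Y∈N , p≈)) =
    (Y ⁻¹) ^ φ q · Y , mul (InN-^ (inv Y∈N) (φ q)) Y∈N
    , trans p≈ (F.solve (x₁ ^ᵉ x₀) (x₁ ⊙ ((x₀ ⁻) ^ᵉ x₁ ⊙ x₀)) refl (Y ∷ φ q ∷ []))

  admissible-⁻¹ : ∀ {x} → Admissible x → Admissible (x ⁻¹⊕)
  admissible-⁻¹ {p , q} (inj₁ (q≈ε , p∈N)) = inj₁ (⁻¹-cong {u = q} {ε} q≈ε , inv p∈N)
  admissible-⁻¹ {p , q} (inj₂ (Y , Y∈N , p≈)) = inj₂ (Y , Y∈N , (begin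
    reduce (p ⁻¹)           ≡⟨ ⁻¹-cong {u = p} {φ q ^ Y} p≈ ⟩
    reduce ((φ q ^ Y) ⁻¹)   ≡⟨ F.solve ((x₀ ^ᵉ x₁) ⁻) ((x₀ ⁻) ^ᵉ x₁) refl (φ q ∷ Y ∷ []) ⟩
    reduce ((φ q ⁻¹) ^ Y)    ≡⟨ ^-cong (φ (q ⁻¹)) (φ q ⁻¹) Y Y (F.eval-⁻¹ ρ q) refl ⟨
    reduce (φ (q ⁻¹) ^ Y)   ∎))
    where open ≡-Reasoning

  admissible-^ : ∀ {x y} → Admissible x → Admissible y → Admissible (x ^⊕ y)
  admissible-^ {p , q} {p' , q'} (inj₁ (q≈ε , p∈N)) _ =
    inj₁ (trans (^-cong q ε q' q' q≈ε refl) (ε-^ q') , InN-^ p∈N p')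
  admissible-^ {p , q} {p' , q'} (inj₂ (Y , Y∈N , p≈)) y with admissible⇒coset {p' , q'} y
  -- With `p'` written as `φ q' · k`, the factor `φ q'` moves inwards past `Y`: it turns `Y` into
  -- `Y ^ φ q'` and `φ q` into `φ (q ^ q')`.
  ... | k , k∈N , p'≈ = inj₂ (Y ^ φ q' · k , mul (InN-^ Y∈N (φ q')) k∈N , (begin
    reduce (p ^ p')                             ≡⟨ ^-cong p (φ q ^ Y) p' (φ q' · k) p≈ p'≈ ⟩
    reduce ((φ q ^ Y) ^ (φ q' · k))             ≡⟨ F.solve (x₀ ^ᵉ x₁ ^ᵉ (x₂ ⊙ x₃)) ((x₀ ^ᵉ x₂) ^ᵉ (x₁ ^ᵉ x₂ ⊙ x₃))
                                                     refl (φ q ∷ Y ∷ φ q' ∷ k ∷ []) ⟩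
    reduce ((φ q ^ φ q') ^ (Y ^ φ q' · k))      ≡⟨ ^-cong (φ (q ^ q')) (φ q ^ φ q') (Y ^ φ q' · k) (Y ^ φ q' · k)
                                                     (φ-^ q q') refl ⟨
    reduce (φ (q ^ q') ^ (Y ^ φ q' · k))        ∎))
    where open ≡-Reasoning

  admissible-φ : ∀ p q → p ≈ φ q → Admissible (p , q)
  admissible-φ p q p≈ = inj₂ (ε , one , trans p≈ (sym (^-ε (φ q))))

  φ-gen : ∀ j → gen j ≈ φ (gen (inject₁ j))
  φ-gen j = cong reduce (sym (trans (++-identityʳ _) (ρ-inject₁ j)))

  -- Stated for arbitrary `js` because the tail of `allFin n` is not of that form, so induction
  -- needs the generality.
  φ-prod : ∀ {k} (js : Vec (Fin n) k) →
           prod (toList (Vec.map gen js)) ≈ φ (prod (toList (Vec.map (λ j → gen (inject₁ j)) js)))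
  φ-prod []       = refl
  φ-prod (j ∷ js) = ·-cong {u = gen j} {ρ (inject₁ j)} {prod (toList (Vec.map gen js))}
    (cong reduce (sym (ρ-inject₁ j))) (φ-prod js)

  All-zip : ∀ {k} (js : Vec (Fin n) k) {p q} → Admissible (p , q) →
            All Admissible (zipWith _,_ (toList (Vec.map gen js) ++ p ∷ [])
                                        (toList (Vec.map (λ j → gen (inject₁ j)) js) ++ q ∷ []))
  All-zip []       pq = pq ∷ []
  All-zip (j ∷ js) pq = admissible-φ (gen j) (gen (inject₁ j)) (φ-gen j) ∷ All-zip js pq

  InN-toList : All (InN V) (toList V)
  InN-toList = VecAll.toList⁺ (VecAll.lookup⁻ (InN-lookup V))

  -- The entries `(r , ε)` satisfy the first alternative; the others lie on the graph of `φ` or are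
  -- inverses of elements of it.
  admissible-PX : All Admissible (PX n m V a)
  admissible-PX = All.++⁺
    (All.map⁺ (All.map (λ p∈N → inj₁ (refl , p∈N)) (All.++⁺ InN-toList (inv (InN-prod InN-toList) ∷ []))))
    (All.++⁺
      (All-zip (Vec.allFin n)
        (admissible-⁻¹ {prod (zs n) , prod (Xs n)} (admissible-φ (prod (zs n)) (prod (Xs n)) (φ-prod (Vec.allFin n)))))
      (admissible-⁻¹ {a , Xlast n} aX ∷ aX ∷ []))
    where
    aX : Admissible (a , Xlast n)
    aX = admissible-φ a (Xlast n) (cong reduce (sym φ-Xlast))

  admissible-Xlast : ∀ b {x} → (b , Xlast n) ≈⊕ x → Admissible x → Σ (Word n) λ Y → InN V Y × a ^ Y ≈ b
  -- A single letter does not reduce to the empty word, which excludes the first alternative.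
  admissible-Xlast b {p , q} (b≈p , X≈q) (inj₁ (q≈ε , _)) with () ← trans X≈q q≈ε
  admissible-Xlast b {p , q} (b≈p , X≈q) (inj₂ (Y , Y∈N , p≈)) = Y , Y∈N , (begin
    reduce (a ^ Y)              ≡⟨ cong (λ u → reduce (u ^ Y)) φ-Xlast ⟨
    reduce (φ (Xlast n) ^ Y)    ≡⟨ ^-cong (φ (Xlast n)) (φ q) Y Y (F.eval-cong ρ {Xlast n} {q} X≈q) refl ⟩
    reduce (φ q ^ Y)            ≡⟨ p≈ ⟨
    reduce p                    ≡⟨ b≈p ⟨
    reduce b                    ∎)
    where open ≡-Reasoning

  module _ (i : Mono n) where
    open Mono i using (fun; inj)
    open MonoProperties i

    -- The moves take place in F_2 ⊕ F_2, so the invariant is carried there as the existence of an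
    -- admissible preimage, up to `≈⊕`.
    ImageAdmissible : Sum 2 2 → Set
    ImageAdmissible y = ∃ λ x → y ≈⊕ fun x × Admissible x

    image-≈ : ∀ {y z} → y ≈⊕ z → ImageAdmissible y → ImageAdmissible z
    image-≈ {y} {z} y≈z (x , y≈ , px) = x , ≈⊕-trans z y (fun x) (≈⊕-sym y z y≈z) y≈ , px

    image-⁻¹ : ∀ {y} → ImageAdmissible y → ImageAdmissible (y ⁻¹⊕)
    image-⁻¹ {y} (x , y≈ , px) =
      x ⁻¹⊕
      , ≈⊕-trans (y ⁻¹⊕) (fun x ⁻¹⊕) (fun (x ⁻¹⊕)) (⁻¹⊕-cong y (fun x) y≈) (≈⊕-sym (fun (x ⁻¹⊕)) (fun x ⁻¹⊕) (fun-⁻¹ x))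
      , admissible-⁻¹ {x} px

    image-^ : ∀ {y z} → ImageAdmissible y → ImageAdmissible z → ImageAdmissible (y ^⊕ z)
    image-^ {y} {z} (x , y≈ , px) (x' , z≈ , px') =
      x ^⊕ x'
      , ≈⊕-trans (y ^⊕ z) (fun x ^⊕ fun x') (fun (x ^⊕ x'))
          (^⊕-cong y (fun x) z (fun x') y≈ z≈) (≈⊕-sym (fun (x ^⊕ x')) (fun x ^⊕ fun x') (fun-^ x x'))
      , admissible-^ {x} {x'} px px'

    image-Star : ∀ {s t} → HurwitzEquiv s t → All ImageAdmissible s → All ImageAdmissible t
    image-Star Star.ε      qs = qs
    image-Star (st ◅ t~u) qs = image-Star t~u
      (All-HStep (λ {y} {z} → image-≈ {y} {z}) (λ {y} → image-⁻¹ {y}) (λ {y} {z} → image-^ {y} {z}) st qs)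

    HurwitzEquiv⇒conjugate : ∀ {b} → HurwitzEquiv (FTLs1 i V a) (FTLs1 i V b) →
                             Σ (Word n) λ Y → InN V Y × a ^ Y ≈ b
    HurwitzEquiv⇒conjugate {b} a~b =
      -- Injectivity of `i` identifies the admissible preimage of the last entry with
      -- `(b , Xlast n)`.
      admissible-Xlast b {x} (inj {b , Xlast n} {x} y≈) px
      where
      initial : All ImageAdmissible (FTLs1 i V a)
      initial = All.map⁺ (All.map (λ {x} px → x , (refl , refl) , px) admissible-PX)
      final : All ImageAdmissible (FTLs1 i V b)
      final = image-Star a~b initial
      last∈ : (b , Xlast n) ∈ PX n m V b
      last∈ = ∈-++⁺ʳ (map (λ r → r , ε) (toList V ++ (prod (toList V) ⁻¹) ∷ []))
        (∈-++⁺ʳ (zipWith _,_ (zs n ++ (prod (zs n) ⁻¹) ∷ []) (Xs n ++ (prod (Xs n) ⁻¹) ∷ [])) (there (here refl)))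
      last : ImageAdmissible (fun (b , Xlast n))
      last = All.lookup final (∈-map⁺ fun last∈)
      x = proj₁ last
      y≈ = proj₁ (proj₂ last)
      px = proj₂ (proj₂ last)

theorem4p2 : (n : ℕ) → 1 ≤ n → (m : ℕ) → (V : Vec (Word n) m) →
    (i : Mono n) → (a b : Word n) →
    HurwitzEquiv (FTLs1 i V a) (FTLs1 i V b) ⇔
    Σ (Word n) (λ Y → InN V Y × ((a ^ Y) ≈ b))
theorem4p2 n _ m V i a b = mk⇔
  (Invariant.HurwitzEquiv⇒conjugate V a i)
  (λ (Y , Y∈N , aʸ≈b) → conjugate⇒HurwitzEquiv i V Y∈N aʸ≈b)
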